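{- Let $1\le d\le n$ be integers. There is a homogeneous multilinear polynomial $f:\{\pm1\}^n\to[-1,1]$ of degree $d$ such that $$\|\hat f_d\|_1=\frac12\cdot\sqrt{\frac1n\cdot\binom nd}.$$
   Context: Every $f:\{\pm1\}^n\to\mathbb{R}$ is uniquely written as $f(x)=\sum_{S\subseteq[n]}\hat f(S)\chi_S(x)$ with $\chi_S(x)=\prod_{j\in S}x_j$ and $\hat f(S)\in\mathbb{R}$. The function $f$ is homogeneous of degree $d$ if $\hat f(S)=0$ whenever $|S|\ne d$. Define $\|\hat f_d\|_1=\sum_{S\subseteq[n],\,|S|=d}|\hat f(S)|$. -}

module Defs where

open import Data.Bool using (if_then_else_; true; false)
open import Data.Fin.Subset using (Subset; inside; outside; ∣_∣)
open import Data.Fin.Subset.Properties using (_∈?_)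
import Data.Integer as ℤ
import Data.Integer.Properties as ℤP
open import Data.List using (List; []; _∷_; _++_; map; foldr; filter; allFin)
open import Data.Nat using (ℕ; zero; suc; z≤n)
import Data.Nat as ℕ
open import Data.Nat.Coprimality as Coprimality using (1-coprimeTo)
import Data.Nat.Properties as ℕP
open import Data.Product using (∃; _×_; _,_; proj₁; proj₂)
open import Data.Rational using
  ( ℚ; 0ℚ; 1ℚ; ½; _+_; _-_; _*_; -_; _≤_; _<_; _≤?_; ↥_; _/_; 1/_; *≤*
  ; positive; nonNegative )
  renaming (∣_∣ to abs)
import Data.Rational as ℚ
open import Data.Rational.Properties
open import Data.Rational.Solver using (module +-*-Solver)
open import Data.Sign using (Sign)
import Data.Sign as Sign
open import Data.Sum using (inj₁; inj₂)
open import Data.Vec using (Vec; []; _∷_; lookup)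
open import Relation.Binary.PropositionalEquality
  using (_≡_; _≢_; refl; sym; trans; cong; cong₂)
open import Relation.Nullary using (Dec; yes; no; does)

open +-*-Solver using (solve; _:=_; _:+_; _:*_; _:-_; :-_; con)

private

  abs≤ : ∀ {p q} → p ≤ q → - p ≤ q → abs p ≤ q
  abs≤ {p} p≤q -p≤q with ∣p∣≡p∨∣p∣≡-p p
  ... | inj₁ e = ≤-trans (≤-reflexive e) p≤q
  ... | inj₂ e = ≤-trans (≤-reflexive e) -p≤q

  p≤abs : ∀ p → p ≤ abs p
  p≤abs p with ≤-total 0ℚ p
  ... | inj₁ 0≤p = ≤-reflexive (sym (0≤p⇒∣p∣≡p 0≤p))
  ... | inj₂ p≤0 = ≤-trans p≤0 (0≤∣p∣ p)

  -p≤abs : ∀ p → - p ≤ abs p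
  -p≤abs p = ≤-trans (p≤abs (- p)) (≤-reflexive (∣-p∣≡∣p∣ p))

  abs-triangle : ∀ p q → abs p ≤ abs q + abs (p - q)
  abs-triangle p q = ≤-trans
    (≤-reflexive (cong abs (solve 2 (λ p q → p := q :+ (p :- q)) refl p q)))
    (∣p+q∣≤∣p∣+∣q∣ q (p - q))

  -- | |p| - |q| | ≤ |p - q|
  abs-lipschitz : ∀ p q → abs (abs p - abs q) ≤ abs (p - q)
  abs-lipschitz p q = abs≤ (shift (abs-triangle p q))
    (≤-trans (≤-reflexive (solve 2 (λ a b → :- (a :- b) := b :- a) refl (abs p) (abs q)))
      (shift (≤-trans (abs-triangle q p) (+-monoʳ-≤ (abs p) (≤-reflexive
        (trans (cong abs (solve 2 (λ p q → q :- p := :- (p :- q)) refl p q)) (∣-p∣≡∣p∣ (p - q))))))))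
    where
    shift : ∀ {a b c} → a ≤ b + c → a - b ≤ c
    shift {a} {b} {c} h = ≤-trans (+-monoˡ-≤ (- b) h)
      (≤-reflexive (solve 2 (λ b c → (b :+ c) :- b := c) refl b c))

  *-mono-≤ : ∀ {a b c d} → 0ℚ ≤ a → 0ℚ ≤ d → a ≤ b → c ≤ d → a * c ≤ b * d
  *-mono-≤ {a} {b} {c} {d} 0≤a 0≤d a≤b c≤d = ≤-trans
    (*-monoˡ-≤-nonNeg a {{nonNegative 0≤a}} c≤d)
    (*-monoʳ-≤-nonNeg d {{nonNegative 0≤d}} a≤b)

  0≤* : ∀ {a b} → 0ℚ ≤ a → 0ℚ ≤ b → 0ℚ ≤ a * b
  0≤* {a} {b} 0≤a 0≤b = ≤-trans (≤-reflexive (sym (*-zeroʳ a)))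
    (*-monoˡ-≤-nonNeg a {{nonNegative 0≤a}} 0≤b)

  0≤+ : ∀ {a b} → 0ℚ ≤ a → 0ℚ ≤ b → 0ℚ ≤ a + b
  0≤+ = +-mono-≤

  p≤p+q : ∀ p {q} → 0ℚ ≤ q → p ≤ p + q
  p≤p+q p 0≤q = ≤-trans (≤-reflexive (sym (+-identityʳ p))) (+-monoʳ-≤ p 0≤q)

  0≤1 : 0ℚ ≤ 1ℚ
  0≤1 = nonNegative⁻¹ 1ℚ

  0<1+ : ∀ {a} → 0ℚ ≤ a → 0ℚ < 1ℚ + a
  0<1+ 0≤a = +-mono-<-≤ (positive⁻¹ 1ℚ) 0≤a

  half : ∀ {ε} → 0ℚ < ε → 0ℚ < ½ * ε
  half {ε} 0<ε = ≤-<-trans (≤-reflexive (sym (*-zeroʳ ½))) (*-monoʳ-<-pos ½ 0<ε)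

  halves : ∀ ε → ½ * ε + ½ * ε ≡ ε
  halves = solve 1 (λ ε → con ½ :* ε :+ con ½ :* ε := ε) refl

  divide : ∀ ε B → 0ℚ < ε → 0ℚ < B → ∃ λ δ → 0ℚ < δ × B * δ ≡ ε
  divide ε B 0<ε 0<B = r * ε , 0<rε ,
    trans (sym (*-assoc B r ε)) (trans (cong (_* ε) (*-inverseʳ B)) (*-identityˡ ε))
    where
    instance
      B>0 = positive 0<B
      B≢0 = pos⇒nonZero B
    r = 1/ B
    0<rε : 0ℚ < r * ε
    0<rε = ≤-<-trans (≤-reflexive (sym (*-zeroʳ r))) (*-monoʳ-<-pos r {{1/pos⇒pos B}} 0<ε)

-- Reals are Cauchy sequences of rationals, identified up to _≃_; operations are termwise.

IsCauchy : (ℕ → ℚ) → Set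
IsCauchy x = ∀ ε → 0ℚ < ε → ∃ λ N → ∀ m n → N ℕ.≤ m → N ℕ.≤ n → abs (x m - x n) ≤ ε

record ℝ : Set where
  constructor mkℝ
  field
    seq    : ℕ → ℚ
    cauchy : IsCauchy seq

open ℝ public

infix 4 _≃_ _≤ᴿ_

_≃_ : ℝ → ℝ → Set
x ≃ y = ∀ ε → 0ℚ < ε → ∃ λ N → ∀ n → N ℕ.≤ n → abs (seq x n - seq y n) ≤ ε

_≤ᴿ_ : ℝ → ℝ → Set
x ≤ᴿ y = ∀ ε → 0ℚ < ε → ∃ λ N → ∀ n → N ℕ.≤ n → seq x n ≤ seq y n + ε

fromℚ : ℚ → ℝ
fromℚ q = mkℝ (λ _ → q) λ ε 0<ε → 0 , λ _ _ _ _ →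
  ≤-trans (≤-reflexive (cong abs (+-inverseʳ q))) (<⇒≤ 0<ε)

0ᴿ 1ᴿ : ℝ
0ᴿ = fromℚ 0ℚ
1ᴿ = fromℚ 1ℚ

infixl 6 _+ᴿ_
infixl 7 _*ᴿ_

_+ᴿ_ : ℝ → ℝ → ℝ
mkℝ x cx +ᴿ mkℝ y cy = mkℝ (λ n → x n + y n) λ ε 0<ε →
  let M , hx = cx (½ * ε) (half 0<ε)
      N , hy = cy (½ * ε) (half 0<ε)
  in M ℕ.⊔ N , λ m n m≥ n≥ → begin
    abs ((x m + y m) - (x n + y n))
      ≡⟨ cong abs (solve 4 (λ a b c d → (a :+ b) :- (c :+ d) := (a :- c) :+ (b :- d))
                     refl (x m) (y m) (x n) (y n)) ⟩
    abs ((x m - x n) + (y m - y n))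
      ≤⟨ ∣p+q∣≤∣p∣+∣q∣ (x m - x n) (y m - y n) ⟩
    abs (x m - x n) + abs (y m - y n)
      ≤⟨ +-mono-≤ (hx m n (ℕP.m⊔n≤o⇒m≤o M N m≥) (ℕP.m⊔n≤o⇒m≤o M N n≥))
                  (hy m n (ℕP.m⊔n≤o⇒n≤o M N m≥) (ℕP.m⊔n≤o⇒n≤o M N n≥)) ⟩
    ½ * ε + ½ * ε
      ≡⟨ halves ε ⟩
    ε ∎
  where open ≤-Reasoning

∣_∣ᴿ : ℝ → ℝ
∣ mkℝ x cx ∣ᴿ = mkℝ (λ n → abs (x n)) λ ε 0<ε →
  let N , hx = cx ε 0<ε
  in N , λ m n m≥ n≥ → ≤-trans (abs-lipschitz (x m) (x n)) (hx m n m≥ n≥)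

private

  eventually-bounded : ∀ {x} → IsCauchy x →
    ∃ λ B → 0ℚ < B × ∃ λ N → ∀ n → N ℕ.≤ n → abs (x n) ≤ B
  eventually-bounded {x} cx with cx 1ℚ (positive⁻¹ 1ℚ)
  ... | N , h = 1ℚ + abs (x N) , 0<1+ (0≤∣p∣ (x N)) , N , λ n n≥ →
    ≤-trans (abs-triangle (x n) (x N))
      (≤-trans (+-monoʳ-≤ (abs (x N)) (h n N n≥ ℕP.≤-refl))
        (≤-reflexive (+-comm (abs (x N)) 1ℚ)))

_*ᴿ_ : ℝ → ℝ → ℝ
mkℝ x cx *ᴿ mkℝ y cy = mkℝ (λ n → x n * y n) λ ε 0<ε →
  let A , 0<A , K , hA = eventually-bounded cx
      B , 0<B , L , hB = eventually-bounded cy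
      δ , 0<δ , e      = divide ε (A + B) 0<ε (+-mono-< 0<A 0<B)
      M , hx           = cx δ 0<δ
      N , hy           = cy δ 0<δ
  in (K ℕ.⊔ L) ℕ.⊔ (M ℕ.⊔ N) , λ m n m≥ n≥ →
    let m≥KL = ℕP.m⊔n≤o⇒m≤o (K ℕ.⊔ L) (M ℕ.⊔ N) m≥
        n≥KL = ℕP.m⊔n≤o⇒m≤o (K ℕ.⊔ L) (M ℕ.⊔ N) n≥
        m≥MN = ℕP.m⊔n≤o⇒n≤o (K ℕ.⊔ L) (M ℕ.⊔ N) m≥
        n≥MN = ℕP.m⊔n≤o⇒n≤o (K ℕ.⊔ L) (M ℕ.⊔ N) n≥
    in begin
    abs (x m * y m - x n * y n)
      ≡⟨ cong abs (solve 4 (λ a b c d → a :* b :- c :* d := a :* (b :- d) :+ d :* (a :- c))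
                     refl (x m) (y m) (x n) (y n)) ⟩
    abs (x m * (y m - y n) + y n * (x m - x n))
      ≤⟨ ∣p+q∣≤∣p∣+∣q∣ (x m * (y m - y n)) (y n * (x m - x n)) ⟩
    abs (x m * (y m - y n)) + abs (y n * (x m - x n))
      ≡⟨ cong₂ _+_ (∣p*q∣≡∣p∣*∣q∣ (x m) (y m - y n)) (∣p*q∣≡∣p∣*∣q∣ (y n) (x m - x n)) ⟩
    abs (x m) * abs (y m - y n) + abs (y n) * abs (x m - x n)
      ≤⟨ +-mono-≤
           (*-mono-≤ (0≤∣p∣ (x m)) (<⇒≤ 0<δ) (hA m (ℕP.m⊔n≤o⇒m≤o K L m≥KL))
              (hy m n (ℕP.m⊔n≤o⇒n≤o M N m≥MN) (ℕP.m⊔n≤o⇒n≤o M N n≥MN)))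
           (*-mono-≤ (0≤∣p∣ (y n)) (<⇒≤ 0<δ) (hB n (ℕP.m⊔n≤o⇒n≤o K L n≥KL))
              (hx m n (ℕP.m⊔n≤o⇒m≤o M N m≥MN) (ℕP.m⊔n≤o⇒m≤o M N n≥MN))) ⟩
    A * δ + B * δ
      ≡⟨ sym (*-distribʳ-+ δ A B) ⟩
    (A + B) * δ
      ≡⟨ e ⟩
    ε ∎
  where open ≤-Reasoning

-- Square roots of rationals, by bisection of [0 , 1 + |q|].
-- For q < 0 this gives 0; √-nonneg and √-square below characterise it for 0 ≤ q.

√width : ℚ → ℕ → ℚ
√width q zero    = 1ℚ + abs q
√width q (suc k) = ½ * √width q k

√lower : ℚ → ℕ → ℚ
√lower q zero    = 0ℚ
√lower q (suc k) =
  let mid = √lower q k + √width q (suc k)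
  in if does (mid * mid ≤? q) then mid else √lower q k

private

  0<width : ∀ q k → 0ℚ < √width q k
  0<width q zero    = 0<1+ (0≤∣p∣ q)
  0<width q (suc k) = half (0<width q k)

  0≤width : ∀ q k → 0ℚ ≤ √width q k
  0≤width q k = <⇒≤ (0<width q k)

  width-step : ∀ q k → √width q (suc k) ≤ √width q k
  width-step q k = ≤-trans (p≤p+q (√width q (suc k)) (0≤width q (suc k)))
    (≤-reflexive (halves (√width q k)))

  lower-step : ∀ q k → √lower q k ≤ √lower q (suc k)
  lower-step q k
    with does ((√lower q k + √width q (suc k)) * (√lower q k + √width q (suc k)) ≤? q)
  ... | true  = p≤p+q (√lower q k) (0≤width q (suc k))
  ... | false = ≤-refl

  upper-step : ∀ q k →
    √lower q (suc k) + √width q (suc k) ≤ √lower q k + √width q k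
  upper-step q k
    with does ((√lower q k + √width q (suc k)) * (√lower q k + √width q (suc k)) ≤? q)
  ... | true  = ≤-reflexive (trans (+-assoc (√lower q k) _ _)
                  (cong (√lower q k +_) (halves (√width q k))))
  ... | false = +-monoʳ-≤ (√lower q k) (width-step q k)

  lower-mono : ∀ q {N n} → N ℕ.≤′ n → √lower q N ≤ √lower q n
  lower-mono q (ℕ.≤′-reflexive refl) = ≤-refl
  lower-mono q {N} (ℕ.≤′-step {n = n} h) = ≤-trans (lower-mono q {N} {n} h) (lower-step q n)

  upper-mono : ∀ q {N n} → N ℕ.≤′ n → √lower q n + √width q n ≤ √lower q N + √width q N
  upper-mono q (ℕ.≤′-reflexive refl) = ≤-refl
  upper-mono q {N} (ℕ.≤′-step {n = n} h) = ≤-trans (upper-step q n) (upper-mono q {N} {n} h)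

  width-mono : ∀ q {N n} → N ℕ.≤′ n → √width q n ≤ √width q N
  width-mono q (ℕ.≤′-reflexive refl) = ≤-refl
  width-mono q {N} (ℕ.≤′-step {n = n} h) = ≤-trans (width-step q n) (width-mono q {N} {n} h)

  lower-difference : ∀ q {N m n} → N ℕ.≤ m → N ℕ.≤ n → √lower q m - √lower q n ≤ √width q N
  lower-difference q {N} {m} {n} m≥ n≥ = begin
    √lower q m - √lower q n
      ≤⟨ +-mono-≤ (≤-trans (p≤p+q (√lower q m) (0≤width q m))
                    (upper-mono q {N} {m} (ℕP.≤⇒≤′ m≥)))
                  (neg-antimono-≤ (lower-mono q {N} {n} (ℕP.≤⇒≤′ n≥))) ⟩
    (√lower q N + √width q N) - √lower q N
      ≡⟨ solve 2 (λ l w → (l :+ w) :- l := w) refl (√lower q N) (√width q N) ⟩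
    √width q N ∎
    where open ≤-Reasoning

  fromℕ : ℕ → ℚ
  fromℕ zero    = 0ℚ
  fromℕ (suc n) = 1ℚ + fromℕ n

  0≤fromℕ : ∀ n → 0ℚ ≤ fromℕ n
  0≤fromℕ zero    = ≤-refl
  0≤fromℕ (suc n) = <⇒≤ (0<1+ (0≤fromℕ n))

  width-decay : ∀ q k → fromℕ (suc k) * √width q k ≤ √width q 0
  width-decay q zero    = ≤-reflexive (*-identityˡ _)
  width-decay q (suc k) = ≤-trans
    (≤-trans
      (≤-reflexive (solve 2 (λ a w → (con 1ℚ :+ (con 1ℚ :+ a)) :* (con ½ :* w)
                                       := w :+ a :* (con ½ :* w)) refl (fromℕ k) (√width q k)))
      (≤-trans
        (+-monoʳ-≤ (√width q k) (*-monoˡ-≤-nonNeg (fromℕ k) {{nonNegative (0≤fromℕ k)}}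
          (width-step q k)))
        (≤-reflexive (solve 2 (λ a w → w :+ a :* w := (con 1ℚ :+ a) :* w)
                        refl (fromℕ k) (√width q k)))))
    (width-decay q k)

  integer : ℕ → ℚ
  integer n = ℚ.mkℚ (ℤ.+ n) 0 (Coprimality.sym (1-coprimeTo n))

  1+integer : ∀ n → 1ℚ + integer n ≡ integer (suc n)
  1+integer n = trans
    (cong (_/ 1) (cong (λ i → ℤ.+ 1 ℤ.+ i) (ℤP.*-identityʳ (ℤ.+ n))))
    (normalize-coprime (Coprimality.sym (1-coprimeTo (suc n))))

  integer≡fromℕ : ∀ n → integer n ≡ fromℕ n
  integer≡fromℕ zero    = refl
  integer≡fromℕ (suc n) = trans (sym (1+integer n)) (cong (1ℚ +_) (integer≡fromℕ n))

  ≤-integer : ∀ p → p ≤ integer ℤ.∣ ↥ p ∣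
  ≤-integer (ℚ.mkℚ (ℤ.+ n) d _) = *≤* (begin
    ℤ.+ n ℤ.* ℤ.+ 1     ≡⟨ ℤP.*-identityʳ (ℤ.+ n) ⟩
    ℤ.+ n               ≤⟨ ℤ.+≤+ (ℕP.m≤m*n n (suc d)) ⟩
    ℤ.+ (n ℕ.* suc d)   ≡⟨ ℤP.pos-* n (suc d) ⟩
    ℤ.+ n ℤ.* ℤ.+ suc d ∎)
    where open ℤP.≤-Reasoning
  ≤-integer (ℚ.mkℚ ℤ.-[1+ n ] d _) = *≤* ℤ.-≤+

  archimedean : ∀ p → ∃ λ n → p ≤ fromℕ n
  archimedean p = ℤ.∣ ↥ p ∣ , ≤-trans (≤-integer p) (≤-reflexive (integer≡fromℕ ℤ.∣ ↥ p ∣))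

  width-vanishes : ∀ q ε → 0ℚ < ε → ∃ λ N → √width q N ≤ ε
  width-vanishes q ε 0<ε with divide (√width q 0) ε (0<width q 0) 0<ε
  ... | p , _ , e with archimedean p
  ...   | n , p≤n = n , *-cancelˡ-≤-pos (fromℕ (suc n)) {{positive (0<1+ (0≤fromℕ n))}} (begin
    fromℕ (suc n) * √width q n ≤⟨ width-decay q n ⟩
    √width q 0                 ≡⟨ sym e ⟩
    ε * p                      ≤⟨ *-monoˡ-≤-nonNeg ε {{nonNegative (<⇒≤ 0<ε)}}
                                    (≤-trans p≤n (≤-trans (≤-reflexive (sym (+-identityˡ _)))
                                      (+-monoˡ-≤ (fromℕ n) 0≤1))) ⟩
    ε * fromℕ (suc n)          ≡⟨ *-comm ε (fromℕ (suc n)) ⟩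
    fromℕ (suc n) * ε          ∎)
    where open ≤-Reasoning

√ : ℚ → ℝ
√ q = mkℝ (√lower q) λ ε 0<ε →
  let N , w≤ε = width-vanishes q ε 0<ε
  in N , λ m n m≥ n≥ → ≤-trans
    (abs≤ (lower-difference q {N} {m} {n} m≥ n≥)
      (≤-trans (≤-reflexive (solve 2 (λ a b → :- (a :- b) := b :- a)
                               refl (√lower q m) (√lower q n)))
        (lower-difference q {N} {n} {m} n≥ m≥)))
    w≤ε

0≤lower : ∀ q k → 0ℚ ≤ √lower q k
0≤lower q k = lower-mono q {0} {k} (ℕP.≤⇒≤′ z≤n)

lower-square : ∀ q → 0ℚ ≤ q → ∀ k → √lower q k * √lower q k ≤ q
lower-square q 0≤q zero = 0≤q
lower-square q 0≤q (suc k) = go (m * m ≤? q)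
  where
  m = √lower q k + √width q (suc k)
  go : (m²≤q? : Dec (m * m ≤ q)) →
    let l = if does m²≤q? then m else √lower q k in l * l ≤ q
  go (yes h) = h
  go (no  _) = lower-square q 0≤q k

upper-square : ∀ q → 0ℚ ≤ q → ∀ k →
  q ≤ (√lower q k + √width q k) * (√lower q k + √width q k)
upper-square q 0≤q zero = ≤-trans (p≤abs q) (≤-trans
  (p≤p+q (abs q) (0≤+ 0≤1 (0≤+ (0≤∣p∣ q) (0≤* (0≤∣p∣ q) (0≤∣p∣ q)))))
  (≤-reflexive (solve 1 (λ a → a :+ (con 1ℚ :+ (a :+ a :* a))
                 := (con 0ℚ :+ (con 1ℚ :+ a)) :* (con 0ℚ :+ (con 1ℚ :+ a))) refl (abs q))))
upper-square q 0≤q (suc k) = go (m * m ≤? q)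
  where
  m = √lower q k + √width q (suc k)
  go : (m²≤q? : Dec (m * m ≤ q)) →
    let u = (if does m²≤q? then m else √lower q k) + √width q (suc k) in q ≤ u * u
  go (yes _) = ≤-trans (upper-square q 0≤q k) (≤-reflexive (cong (λ u → u * u)
    (sym (trans (+-assoc (√lower q k) _ _)
      (cong (√lower q k +_) (halves (√width q k)))))))
  go (no  h) = <⇒≤ (≰⇒> h)

√-nonneg : ∀ q → 0ᴿ ≤ᴿ √ q
√-nonneg q ε 0<ε = 0 , λ n _ → 0≤+ (0≤lower q n) (<⇒≤ 0<ε)

√-square : ∀ q → 0ℚ ≤ q → √ q *ᴿ √ q ≃ fromℚ q
√-square q 0≤q ε 0<ε = N , error
  where
  B = √width q 0
  0<B = 0<width q 0

  scale = divide ε (B + B) 0<ε (+-mono-< 0<B 0<B)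
  δ     = proj₁ scale
  0<δ   = proj₁ (proj₂ scale)
  2Bδ≡ε = proj₂ (proj₂ scale)

  N   = proj₁ (width-vanishes q δ 0<δ)
  w≤δ = proj₂ (width-vanishes q δ 0<δ)

  sandwich : ∀ l w → 0ℚ ≤ l → 0ℚ ≤ w → l + w ≤ B → w ≤ δ →
    l * l ≤ q → q ≤ (l + w) * (l + w) → abs (l * l - q) ≤ ε
  sandwich l w 0≤l 0≤w l+w≤B w≤δ l²≤q q≤u² = abs≤
    (≤-trans (+-monoˡ-≤ (- q) l²≤q) (≤-trans (≤-reflexive (+-inverseʳ q)) (<⇒≤ 0<ε)))
    (begin
      - (l * l - q)
        ≡⟨ solve 2 (λ s q → :- (s :- q) := q :- s) refl (l * l) q ⟩
      q - l * l
        ≤⟨ +-monoˡ-≤ (- (l * l)) q≤u² ⟩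
      (l + w) * (l + w) - l * l
        ≡⟨ solve 2 (λ l w → (l :+ w) :* (l :+ w) :- l :* l := ((l :+ w) :+ l) :* w) refl l w ⟩
      ((l + w) + l) * w
        ≤⟨ *-mono-≤ (0≤+ (0≤+ 0≤l 0≤w) 0≤l) (<⇒≤ 0<δ)
             (+-mono-≤ l+w≤B (≤-trans (p≤p+q l 0≤w) l+w≤B)) w≤δ ⟩
      (B + B) * δ
        ≡⟨ 2Bδ≡ε ⟩
      ε ∎)
    where open ≤-Reasoning

  error : ∀ n → N ℕ.≤ n → abs (√lower q n * √lower q n - q) ≤ ε
  error n n≥ = sandwich (√lower q n) (√width q n) (0≤lower q n) (0≤width q n)
    (≤-trans (upper-mono q {0} {n} (ℕP.≤⇒≤′ z≤n)) (≤-reflexive (+-identityˡ B)))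
    (≤-trans (width-mono q {N} {n} (ℕP.≤⇒≤′ n≥)) w≤δ)
    (lower-square q 0≤q n) (upper-square q 0≤q n)

-- {±1}ⁿ, with Sign as the multiplicative group {±1}
Cube : ℕ → Set
Cube n = Vec Sign n

fromSign : Sign → ℝ
fromSign Sign.+ = fromℚ 1ℚ
fromSign Sign.- = fromℚ (- 1ℚ)

-- χ S x = ∏_{j ∈ S} x_j
χ : ∀ {n} → Subset n → Cube n → Sign
χ {n} S x = foldr Sign._*_ Sign.+ (map (lookup x) (filter (_∈? S) (allFin n)))

subsets : ∀ n → List (Subset n)
subsets zero    = [] ∷ []
subsets (suc n) = map (outside ∷_) (subsets n) ++ map (inside ∷_) (subsets n)

∑ : ∀ {A : Set} → List A → (A → ℝ) → ℝ
∑ as g = foldr (λ a s → g a +ᴿ s) 0ᴿ as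

-- f = ∑_S f̂ S · χ S pointwise; this determines f̂ up to _≃_.
_HasFourierCoefficients_ : ∀ {n} → (Cube n → ℝ) → (Subset n → ℝ) → Set
_HasFourierCoefficients_ {n} f f̂ =
  ∀ x → f x ≃ ∑ (subsets n) (λ S → f̂ S *ᴿ fromSign (χ S x))

Homogeneous : ∀ {n} → ℕ → (Subset n → ℝ) → Set
Homogeneous d f̂ = ∀ S → ∣ S ∣ ≢ d → f̂ S ≃ 0ᴿ

ℓ¹-norm : ∀ {n} → ℕ → (Subset n → ℝ) → ℝ
ℓ¹-norm {n} d f̂ = ∑ (filter (λ S → ∣ S ∣ ℕ.≟ d) (subsets n)) (λ S → ∣ f̂ S ∣ᴿ)

{-# OPTIONS --safe #-}
module Submission where

-- Write N = n C d. The polynomial is a constant multiple of a signed sum of characters,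
--
--   f = (1 / 2N) · √(N / n) · g,   g x = ∑ over the d-subsets S of ε S · χ S x,   ε S = ±1.
--
-- Its N coefficients of degree d have absolute value (1 / 2N) · √(N / n), so the ℓ¹ norm is
-- ½ · √(N / n) whatever the signs are, and |f| ≤ 1 as soon as (g x)² ≤ 4nN for all x.
-- Signs with this property exist by the 2n-th moment method.  For uniformly random signs
-- each g x is distributed as the endpoint of an N-step simple random walk from 0, whose
-- moments satisfy
--
--   E v²ᵏ⁺² ≤ N · (2k + 1) · E v²ᵏ
--
-- (walk-by-parts, a discrete integration by parts, applied to odd-increment, the trapezoid
-- rule for the convex function v²ᵏ).  As 2k + 1 ≤ 2n for k < n, this gives E v²ⁿ ≤ (2nN)ⁿ
-- (walk-moment).  Summing over the 2ⁿ points of the cube, some choice of signs has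
-- ∑ₓ (g x)²ⁿ ≤ 2ⁿ (2nN)ⁿ = (4nN)ⁿ, so each term (g x)²ⁿ is at most (4nN)ⁿ (balanced-signs).
-- The choice is made constructively, one sign at a time, keeping the conditional expectation
-- of the sum from increasing (exists-signs).
--
-- Every real number involved is a rational multiple of √(N / n), and the lower bisection
-- approximations l of √(N / n) satisfy 0 ≤ l and l² ≤ N / n.  Hence all the required relations
-- hold exactly for each term of the approximating sequences, without error terms.

open import Defs
open import Data.Fin.Subset using (Subset)
open import Data.Integer using (+_)
open import Data.Nat using (ℕ; _≤_; >-nonZero)
open import Data.Nat.Combinatorics using (_C_)
open import Data.Nat.Properties using (≤-trans)
open import Data.Product using (Σ-syntax; _×_)
open import Data.Rational using (½; 1ℚ; -_; _/_; _*_)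

open import Algebra.Bundles using (CommutativeRing)
open import Data.Bool using (true; false; if_then_else_)
import Data.Bool.Properties as Bool
open import Data.Fin.Subset using (inside; outside; ∣_∣)
import Data.Integer as ℤ
import Data.Integer.Properties as ℤP
open import Data.List using (List; []; _∷_; _++_; map; filter; length; foldr)
open import Data.List.Membership.Propositional using (_∈_)
open import Data.List.Membership.Propositional.Properties using (∈-map⁺; ∈-map⁻; ∈-++⁺ˡ; ∈-++⁺ʳ)
open import Data.List.Properties using (length-map; length-++; filter-++; filter-≐; filter-none)
open import Data.List.Relation.Unary.All as All using (All; []; _∷_)
open import Data.List.Relation.Unary.All.Properties using (all-filter)
open import Data.List.Relation.Unary.Any using (here; there)
open import Data.List.Relation.Unary.AllPairs using ([]; _∷_)
open import Data.List.Relation.Unary.Unique.Propositional using (Unique)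
import Data.List.Relation.Unary.Unique.Propositional.Properties as Unique
open import Data.Nat using (zero; suc; z≤n; s≤s; NonZero)
import Data.Nat as ℕ
open import Data.Nat.Combinatorics using (nCk+nC[k+1]≡[n+1]C[k+1])
import Data.Nat.Properties as ℕP
open import Data.Product using (_,_; proj₁; proj₂)
open import Data.Rational using (ℚ; 0ℚ; _+_; _-_; nonNegative; positive; toℚᵘ)
  renaming (_≤_ to _≤ℚ_; _<_ to _<ℚ_; ∣_∣ to abs)
import Data.Rational.Properties as ℚP
open import Data.Rational.Solver using (module +-*-Solver)
import Data.Rational.Unnormalised as ℚᵘ
import Data.Rational.Unnormalised.Properties as ℚᵘP
open import Data.Sign using (Sign)
import Data.Sign as Sign
open import Data.Sum using (inj₁; inj₂)
open import Data.Vec using ([]; _∷_)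
import Data.Vec.Properties as Vec
open import Level using (0ℓ)
open import Function using (_∘_)
open import Relation.Binary.Definitions using (DecidableEquality)
open import Relation.Binary.PropositionalEquality
  using (_≡_; _≢_; refl; sym; trans; cong; cong₂; subst; module ≡-Reasoning)
open import Relation.Nullary using (¬_; Dec; yes; no; does; contradiction)
open import Relation.Nullary.Decidable using (dec-true; dec-false)
open import Relation.Unary using (Pred; Decidable)

open import Algebra.Properties.CommutativeSemiring.Exp
  (CommutativeRing.commutativeSemiring ℚP.+-*-commutativeRing) using (_^_; ^-distrib-*)
open +-*-Solver using (solve; _:=_; _:+_; _:*_; _:-_; :-_; con)

-- Order on the rationals

≤-from-gap : ∀ {p q r} → p + r ≡ q → 0ℚ ≤ℚ r → p ≤ℚ q
≤-from-gap {p} {q} {r} e 0≤r = begin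
  p       ≡⟨ ℚP.+-identityʳ p ⟨
  p + 0ℚ  ≤⟨ ℚP.+-monoʳ-≤ p 0≤r ⟩
  p + r   ≡⟨ e ⟩
  q       ∎
  where open ℚP.≤-Reasoning

*-monoˡ : ∀ {r p q} → 0ℚ ≤ℚ r → p ≤ℚ q → r * p ≤ℚ r * q
*-monoˡ {r} 0≤r = ℚP.*-monoˡ-≤-nonNeg r {{nonNegative 0≤r}}

*-nonneg : ∀ {p q} → 0ℚ ≤ℚ p → 0ℚ ≤ℚ q → 0ℚ ≤ℚ p * q
*-nonneg {p} {q} 0≤p 0≤q = begin
  0ℚ      ≡⟨ ℚP.*-zeroʳ p ⟨
  p * 0ℚ  ≤⟨ *-monoˡ 0≤p 0≤q ⟩
  p * q   ∎
  where open ℚP.≤-Reasoning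

*-mono : ∀ {p q r s} → 0ℚ ≤ℚ q → 0ℚ ≤ℚ r → p ≤ℚ q → r ≤ℚ s → p * r ≤ℚ q * s
*-mono {p} {q} {r} {s} 0≤q 0≤r p≤q r≤s = begin
  p * r  ≤⟨ ℚP.*-monoʳ-≤-nonNeg r {{nonNegative 0≤r}} p≤q ⟩
  q * r  ≤⟨ *-monoˡ 0≤q r≤s ⟩
  q * s  ∎
  where open ℚP.≤-Reasoning

square-nonneg : ∀ p → 0ℚ ≤ℚ p * p
square-nonneg p with ℚP.≤-total 0ℚ p
... | inj₁ 0≤p = *-nonneg 0≤p 0≤p
... | inj₂ p≤0 = ℚP.≤-trans (*-nonneg 0≤-p 0≤-p)
  (ℚP.≤-reflexive (solve 1 (λ p → (:- p) :* (:- p) := p :* p) refl p))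
  where
  0≤-p : 0ℚ ≤ℚ - p
  0≤-p = ℚP.neg-antimono-≤ p≤0

½-nonneg : 0ℚ ≤ℚ ½
½-nonneg = ℚP.nonNegative⁻¹ ½

1-nonneg : 0ℚ ≤ℚ 1ℚ
1-nonneg = ℚP.nonNegative⁻¹ 1ℚ

2ℚ : ℚ
2ℚ = 1ℚ + 1ℚ

^-nonneg : ∀ {p} → 0ℚ ≤ℚ p → ∀ k → 0ℚ ≤ℚ p ^ k
^-nonneg 0≤p zero    = 1-nonneg
^-nonneg 0≤p (suc k) = *-nonneg 0≤p (^-nonneg 0≤p k)

^-mono-< : ∀ {p q} → 0ℚ ≤ℚ p → p <ℚ q → ∀ k → p ^ suc k <ℚ q ^ suc k
^-mono-< {p} {q} 0≤p p<q zero    = ℚP.*-monoˡ-<-pos 1ℚ p<q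
^-mono-< {p} {q} 0≤p p<q (suc k) = begin-strict
  p * p ^ suc k  ≤⟨ *-monoˡ 0≤p (ℚP.<⇒≤ (^-mono-< 0≤p p<q k)) ⟩
  p * q ^ suc k  <⟨ ℚP.*-monoˡ-<-pos (q ^ suc k) {{positive 0<q^}} p<q ⟩
  q * q ^ suc k  ∎
  where
  open ℚP.≤-Reasoning
  0<q^ : 0ℚ <ℚ q ^ suc k
  0<q^ = ℚP.≤-<-trans (^-nonneg 0≤p (suc k)) (^-mono-< 0≤p p<q k)

^-cancel-≤ : ∀ {p q} → 0ℚ ≤ℚ q → ∀ k → p ^ suc k ≤ℚ q ^ suc k → p ≤ℚ q
^-cancel-≤ {p} {q} 0≤q k h = ℚP.≮⇒≥ λ q<p →
  ℚP.<-irrefl refl (ℚP.<-≤-trans (^-mono-< 0≤q q<p k) h)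

square≤1⇒bounded : ∀ p → p * p ≤ℚ 1ℚ → (- 1ℚ ≤ℚ p) × (p ≤ℚ 1ℚ)
square≤1⇒bounded p p²≤1 = lower , upper p p²≤1
  where
  upper : ∀ p → p * p ≤ℚ 1ℚ → p ≤ℚ 1ℚ
  upper p h = ^-cancel-≤ 1-nonneg 1 (begin
    p * (p * 1ℚ)    ≡⟨ cong (p *_) (ℚP.*-identityʳ p) ⟩
    p * p           ≤⟨ h ⟩
    1ℚ              ∎)
    where open ℚP.≤-Reasoning
  lower : - 1ℚ ≤ℚ p
  lower = subst (- 1ℚ ≤ℚ_) (solve 1 (λ p → :- (:- p) := p) refl p)
    (ℚP.neg-antimono-≤ (upper (- p)
      (subst (_≤ℚ 1ℚ) (solve 1 (λ p → p :* p := (:- p) :* (:- p)) refl p) p²≤1)))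

-- Natural numbers as rationals

-- The embedding of ℕ in ℚ, in the form in which integers occur in the theorem.
ι : ℕ → ℚ
ι n = + n / 1

ι-suc : ∀ n → ι (suc n) ≡ 1ℚ + ι n
ι-suc n = ℚP.toℚᵘ-injective (begin
  toℚᵘ (ι (suc n))             ≈⟨ ℚP.toℚᵘ-fromℚᵘ (ℚᵘ.mkℚᵘ (+ suc n) 0) ⟩
  ℚᵘ.mkℚᵘ (+ suc n) 0          ≈⟨ ℚᵘ.*≡* (cong (λ i → (+ 1 ℤ.+ i) ℤ.* + 1) (sym (ℤP.*-identityʳ (+ n)))) ⟩
  ℚᵘ.1ℚᵘ ℚᵘ.+ ℚᵘ.mkℚᵘ (+ n) 0  ≈⟨ ℚᵘP.+-congʳ ℚᵘ.1ℚᵘ (ℚᵘP.≃-sym (ℚP.toℚᵘ-fromℚᵘ (ℚᵘ.mkℚᵘ (+ n) 0))) ⟩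
  ℚᵘ.1ℚᵘ ℚᵘ.+ toℚᵘ (ι n)       ≈⟨ ℚᵘP.≃-sym (ℚP.toℚᵘ-homo-+ 1ℚ (ι n)) ⟩
  toℚᵘ (1ℚ + ι n)              ∎)
  where open ℚᵘP.≃-Reasoning

ι-+ : ∀ m n → ι (m ℕ.+ n) ≡ ι m + ι n
ι-+ zero    n = sym (ℚP.+-identityˡ (ι n))
ι-+ (suc m) n = begin
  ι (suc (m ℕ.+ n))  ≡⟨ ι-suc (m ℕ.+ n) ⟩
  1ℚ + ι (m ℕ.+ n)   ≡⟨ cong (_+_ 1ℚ) (ι-+ m n) ⟩
  1ℚ + (ι m + ι n)   ≡⟨ ℚP.+-assoc 1ℚ (ι m) (ι n) ⟨
  1ℚ + ι m + ι n     ≡⟨ cong (_+ ι n) (ι-suc m) ⟨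
  ι (suc m) + ι n    ∎
  where open ≡-Reasoning

ι-nonneg : ∀ n → 0ℚ ≤ℚ ι n
ι-nonneg n = ℚP.nonNegative⁻¹ (ι n) {{ℚP.normalize-nonNeg n 1}}

ι-mono : ∀ {m n} → m ≤ n → ι m ≤ℚ ι n
ι-mono {n = n} z≤n = ι-nonneg n
ι-mono {suc m} {suc n} (s≤s h) = begin
  ι (suc m)  ≡⟨ ι-suc m ⟩
  1ℚ + ι m   ≤⟨ ℚP.+-monoʳ-≤ 1ℚ (ι-mono h) ⟩
  1ℚ + ι n   ≡⟨ ι-suc n ⟨
  ι (suc n)  ∎
  where open ℚP.≤-Reasoning

1/n*n≡1 : ∀ n .{{_ : NonZero n}} → (+ 1 / n) * ι n ≡ 1ℚ
1/n*n≡1 (suc n) = ℚP.toℚᵘ-injective (begin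
  toℚᵘ ((+ 1 / suc n) * ι (suc n))          ≈⟨ ℚP.toℚᵘ-homo-* (+ 1 / suc n) (ι (suc n)) ⟩
  toℚᵘ (+ 1 / suc n) ℚᵘ.* toℚᵘ (ι (suc n))  ≈⟨ ℚᵘP.*-cong (ℚP.toℚᵘ-fromℚᵘ (ℚᵘ.mkℚᵘ (+ 1) n))
                                                (ℚP.toℚᵘ-fromℚᵘ (ℚᵘ.mkℚᵘ (+ suc n) 0)) ⟩
  ℚᵘ.1/ p ℚᵘ.* p                            ≈⟨ ℚᵘP.*-inverseˡ p ⟩
  ℚᵘ.1ℚᵘ                                    ∎)
  where
  open ℚᵘP.≃-Reasoning
  p = ℚᵘ.mkℚᵘ (+ suc n) 0

-- Differences of odd powers

-- The quotient (A ^ j - B ^ j) / (A - B), as the sum of the A ^ i * B ^ (j - 1 - i)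
-- so that A = B is allowed.
quotient : ℚ → ℚ → ℕ → ℚ
quotient A B zero    = 0ℚ
quotient A B (suc j) = A ^ j + B * quotient A B j

quotient-nonneg : ∀ {A B} → 0ℚ ≤ℚ A → 0ℚ ≤ℚ B → ∀ j → 0ℚ ≤ℚ quotient A B j
quotient-nonneg 0≤A 0≤B zero    = ℚP.≤-refl
quotient-nonneg 0≤A 0≤B (suc j) =
  ℚP.+-mono-≤ (^-nonneg 0≤A j) (*-nonneg 0≤B (quotient-nonneg 0≤A 0≤B j))

power-difference : ∀ A B j → A ^ j - B ^ j ≡ (A - B) * quotient A B j
power-difference A B zero    = sym (ℚP.*-zeroʳ (A - B))
power-difference A B (suc j) = begin
  A * P - B * Q              ≡⟨ solve 4 (λ A B P Q → A :* P :- B :* Q := (A :- B) :* P :+ B :* (P :- Q))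
                                  refl A B P Q ⟩
  (A - B) * P + B * (P - Q)  ≡⟨ cong (λ z → (A - B) * P + B * z) (power-difference A B j) ⟩
  (A - B) * P + B * ((A - B) * U)
                             ≡⟨ solve 4 (λ A B P U → (A :- B) :* P :+ B :* ((A :- B) :* U)
                                                       := (A :- B) :* (P :+ B :* U)) refl A B P U ⟩
  (A - B) * (P + B * U)      ∎
  where
  open ≡-Reasoning
  P = A ^ j
  Q = B ^ j
  U = quotient A B j

-- For j > 0 the mean of the j summands A ^ i * B ^ (j - 1 - i) is at most that of A ^ (j - 1)
-- and B ^ (j - 1), and (A + B) * (A ^ (j - 1) + B ^ (j - 1)) is at most 2 * (A ^ j + B ^ j).
quotient-bound : ∀ {A B} → 0ℚ ≤ℚ A → 0ℚ ≤ℚ B → ∀ j →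
  (A + B) * quotient A B j ≤ℚ ι j * (A ^ j + B ^ j)
quotient-bound {A} {B} 0≤A 0≤B zero    = ℚP.≤-reflexive (ℚP.*-zeroʳ (A + B))
quotient-bound {A} {B} 0≤A 0≤B (suc j) = begin
  (A + B) * (P + B * U)
    ≡⟨ solve 5 (λ A B P Q U → (A :+ B) :* (P :+ B :* U)
         := con ½ :* (A :+ B) :* (((P :+ Q) :+ (P :- Q)) :+ (B :* U :+ B :* U))) refl A B P Q U ⟩
  ½ * (A + B) * (((P + Q) + (P - Q)) + (B * U + B * U))
    ≡⟨ cong (λ z → ½ * (A + B) * (((P + Q) + z) + (B * U + B * U))) (power-difference A B j) ⟩
  ½ * (A + B) * (((P + Q) + (A - B) * U) + (B * U + B * U))
    ≡⟨ solve 4 (λ A B S U → con ½ :* (A :+ B) :* ((S :+ (A :- B) :* U) :+ (B :* U :+ B :* U))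
         := con ½ :* (A :+ B) :* (S :+ (A :+ B) :* U)) refl A B (P + Q) U ⟩
  ½ * (A + B) * ((P + Q) + (A + B) * U)
    ≤⟨ *-monoˡ (*-nonneg ½-nonneg (ℚP.+-mono-≤ 0≤A 0≤B))
         (ℚP.+-monoʳ-≤ (P + Q) (quotient-bound 0≤A 0≤B j)) ⟩
  ½ * (A + B) * ((P + Q) + ι j * (P + Q))
    ≤⟨ ≤-from-gap gap (*-nonneg (*-nonneg ½-nonneg (ℚP.+-mono-≤ 1-nonneg (ι-nonneg j)))
         (*-nonneg (square-nonneg (A - B)) (quotient-nonneg 0≤A 0≤B j))) ⟩
  (1ℚ + ι j) * (A * P + B * Q)
    ≡⟨ cong (_* (A * P + B * Q)) (ι-suc j) ⟨
  ι (suc j) * (A * P + B * Q) ∎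
  where
  open ℚP.≤-Reasoning
  P = A ^ j
  Q = B ^ j
  U = quotient A B j
  -- Chebyshev's sum inequality for (A , B) and (P , Q), with its defect made explicit.
  gap : ½ * (A + B) * ((P + Q) + ι j * (P + Q)) + ½ * (1ℚ + ι j) * ((A - B) * (A - B) * U)
        ≡ (1ℚ + ι j) * (A * P + B * Q)
  gap = trans
    (cong (λ z → ½ * (A + B) * ((P + Q) + ι j * (P + Q)) + ½ * (1ℚ + ι j) * z)
      (trans (ℚP.*-assoc (A - B) (A - B) U) (cong ((A - B) *_) (sym (power-difference A B j)))))
    (solve 5 (λ A B P Q i → con ½ :* (A :+ B) :* ((P :+ Q) :+ i :* (P :+ Q))
                              :+ con ½ :* (con 1ℚ :+ i) :* ((A :- B) :* (P :- Q))
                          := (con 1ℚ :+ i) :* (A :* P :+ B :* Q)) refl A B P Q (ι j))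

-- even k v = v ^ (2 k) and odd k v = v ^ (2 k + 1), with evenness built in through v * v.
even odd : ℕ → ℚ → ℚ
even k v = (v * v) ^ k
odd  k v = v * even k v

-- The left side is the integral of (2 j + 1) v²ʲ over [u - 1 , u + 1]; the right side is its
-- estimate by the trapezoid rule, too large because the integrand is convex.  Algebraically,
-- with A = (u + 1)² and B = (u - 1)², the left side is 4u² · quotient A B j + A ^ j + B ^ j,
-- and 4u² ≤ 2 (A + B).
odd-increment : ∀ j u →
  odd j (u + 1ℚ) - odd j (u - 1ℚ) ≤ℚ (ι j + ι j + 1ℚ) * (even j (u + 1ℚ) + even j (u - 1ℚ))
odd-increment j u = begin
  a * P - b * Q
    ≡⟨ solve 3 (λ u P Q → (u :+ con 1ℚ) :* P :- (u :- con 1ℚ) :* Q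
         := u :* (P :- Q) :+ (P :+ Q)) refl u P Q ⟩
  u * (P - Q) + (P + Q)
    ≡⟨ cong (λ z → u * z + (P + Q)) (power-difference A B j) ⟩
  u * ((A - B) * U) + (P + Q)
    ≤⟨ ≤-from-gap (solve 3 (λ u U S →
         let A = (u :+ con 1ℚ) :* (u :+ con 1ℚ)
             B = (u :- con 1ℚ) :* (u :- con 1ℚ)
         in (u :* ((A :- B) :* U) :+ S) :+ con (2ℚ + 2ℚ) :* U
            := ((A :+ B) :* U :+ (A :+ B) :* U) :+ S) refl u U (P + Q))
         (*-nonneg (ℚP.nonNegative⁻¹ (2ℚ + 2ℚ)) (quotient-nonneg 0≤A 0≤B j)) ⟩
  ((A + B) * U + (A + B) * U) + (P + Q)
    ≤⟨ ℚP.+-monoˡ-≤ (P + Q) (ℚP.+-mono-≤ (quotient-bound 0≤A 0≤B j) (quotient-bound 0≤A 0≤B j)) ⟩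
  (ι j * (P + Q) + ι j * (P + Q)) + (P + Q)
    ≡⟨ solve 2 (λ i S → (i :* S :+ i :* S) :+ S := (i :+ i :+ con 1ℚ) :* S) refl (ι j) (P + Q) ⟩
  (ι j + ι j + 1ℚ) * (P + Q) ∎
  where
  open ℚP.≤-Reasoning
  a = u + 1ℚ
  b = u - 1ℚ
  A = a * a
  B = b * b
  P = A ^ j
  Q = B ^ j
  U = quotient A B j
  0≤A = square-nonneg a
  0≤B = square-nonneg b

-- Moments of the simple random walk

-- walk m φ h is the expectation of φ at the position reached from h by m independent steps ±1.
walk : ℕ → (ℚ → ℚ) → ℚ → ℚ
walk zero    φ h = φ h
walk (suc m) φ h = ½ * (walk m φ (h + 1ℚ) + walk m φ (h - 1ℚ))

walk-cong : ∀ m {φ ψ} → (∀ v → φ v ≡ ψ v) → ∀ h → walk m φ h ≡ walk m ψ h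
walk-cong zero    e h = e h
walk-cong (suc m) e h = cong₂ (λ a b → ½ * (a + b)) (walk-cong m e _) (walk-cong m e _)

walk-const : ∀ m c h → walk m (λ _ → c) h ≡ c
walk-const zero    c h = refl
walk-const (suc m) c h = trans
  (cong₂ (λ a b → ½ * (a + b)) (walk-const m c _) (walk-const m c _))
  (solve 1 (λ c → con ½ :* (c :+ c) := c) refl c)

walk-+ : ∀ m φ ψ h → walk m (λ v → φ v + ψ v) h ≡ walk m φ h + walk m ψ h
walk-+ zero    φ ψ h = refl
walk-+ (suc m) φ ψ h = trans
  (cong₂ (λ a b → ½ * (a + b)) (walk-+ m φ ψ _) (walk-+ m φ ψ _))
  (solve 4 (λ a b c d → con ½ :* ((a :+ b) :+ (c :+ d)) := con ½ :* (a :+ c) :+ con ½ :* (b :+ d))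
    refl (walk m φ (h + 1ℚ)) (walk m ψ (h + 1ℚ)) (walk m φ (h - 1ℚ)) (walk m ψ (h - 1ℚ)))

module _ {F K : ℚ → ℚ} {c : ℚ}
  (increment : ∀ u → F (u + 1ℚ) - F (u - 1ℚ) ≤ℚ c * (K (u + 1ℚ) + K (u - 1ℚ))) where

  -- The increment inequality is preserved by averaging over translates.
  walk-increment : ∀ m h →
    walk m F (h + 1ℚ) - walk m F (h - 1ℚ) ≤ℚ c * (walk m K (h + 1ℚ) + walk m K (h - 1ℚ))
  walk-increment zero    h = increment h
  walk-increment (suc m) h = begin
    ½ * (f₂ + f₀) - ½ * (f₀′ + f₋₂)
      ≡⟨ solve 4 (λ a b c d → con ½ :* (a :+ b) :- con ½ :* (c :+ d)
           := con ½ :* ((a :- c) :+ (b :- d))) refl f₂ f₀ f₀′ f₋₂ ⟩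
    ½ * ((f₂ - f₀′) + (f₀ - f₋₂))
      ≡⟨ cong₂ (λ x y → ½ * ((f₂ - walk m F x) + (walk m F y - f₋₂))) (sym swap) swap ⟩
    ½ * ((f₂ - f₀) + (f₀′ - f₋₂))
      ≤⟨ *-monoˡ ½-nonneg (ℚP.+-mono-≤ (walk-increment m (h + 1ℚ)) (walk-increment m (h - 1ℚ))) ⟩
    ½ * (c * (walk m K (h + 1ℚ + 1ℚ) + walk m K (h + 1ℚ - 1ℚ))
         + c * (walk m K (h - 1ℚ + 1ℚ) + walk m K (h - 1ℚ - 1ℚ)))
      ≡⟨ solve 5 (λ c x y z w → con ½ :* (c :* (x :+ y) :+ c :* (z :+ w))
           := c :* (con ½ :* (x :+ y) :+ con ½ :* (z :+ w))) refl c
           (walk m K (h + 1ℚ + 1ℚ)) (walk m K (h + 1ℚ - 1ℚ))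
           (walk m K (h - 1ℚ + 1ℚ)) (walk m K (h - 1ℚ - 1ℚ)) ⟩
    c * (walk (suc m) K (h + 1ℚ) + walk (suc m) K (h - 1ℚ)) ∎
    where
    open ℚP.≤-Reasoning
    f₂  = walk m F (h + 1ℚ + 1ℚ)
    f₀  = walk m F (h + 1ℚ - 1ℚ)
    f₀′ = walk m F (h - 1ℚ + 1ℚ)
    f₋₂ = walk m F (h - 1ℚ - 1ℚ)
    -- f₀ and f₀′ are walks from the same point, so they can be exchanged to match the
    -- increments over [h , h + 2] and [h - 2 , h].
    swap : h + 1ℚ - 1ℚ ≡ h - 1ℚ + 1ℚ
    swap = solve 1 (λ h → h :+ con 1ℚ :- con 1ℚ := h :- con 1ℚ :+ con 1ℚ) refl h

  -- Discrete integration by parts.  The displacement v - h is a sum of m steps s = ±1, and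
  -- averaging s * F v over s alone leaves half of an increment of F, which is at most
  -- c times the average of K.
  walk-by-parts : ∀ m h → walk m (λ v → (v - h) * F v) h ≤ℚ ι m * (c * walk m K h)
  walk-by-parts zero    h = ℚP.≤-reflexive
    (solve 3 (λ h f k → (h :- h) :* f := con 0ℚ :* k) refl h (F h) (c * K h))
  walk-by-parts (suc m) h = begin
    ½ * (walk m G (h + 1ℚ) + walk m G (h - 1ℚ))
      ≡⟨ cong₂ (λ x y → ½ * (x + y)) up down ⟩
    ½ * ((G₊ + f₊) + (G₋ - f₋))
      ≡⟨ solve 4 (λ a b c d → con ½ :* ((a :+ b) :+ (c :- d)) := con ½ :* ((a :+ c) :+ (b :- d)))
           refl G₊ f₊ G₋ f₋ ⟩
    ½ * ((G₊ + G₋) + (f₊ - f₋))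
      ≤⟨ *-monoˡ ½-nonneg (ℚP.+-mono-≤
           (ℚP.+-mono-≤ (walk-by-parts m (h + 1ℚ)) (walk-by-parts m (h - 1ℚ)))
           (walk-increment m h)) ⟩
    ½ * ((ι m * (c * k₊) + ι m * (c * k₋)) + c * (k₊ + k₋))
      ≡⟨ solve 4 (λ i c x y → con ½ :* ((i :* (c :* x) :+ i :* (c :* y)) :+ c :* (x :+ y))
           := (con 1ℚ :+ i) :* (c :* (con ½ :* (x :+ y)))) refl (ι m) c k₊ k₋ ⟩
    (1ℚ + ι m) * (c * (½ * (k₊ + k₋)))
      ≡⟨ cong (_* (c * (½ * (k₊ + k₋)))) (ι-suc m) ⟨
    ι (suc m) * (c * (½ * (k₊ + k₋))) ∎
    where
    open ℚP.≤-Reasoning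
    G : ℚ → ℚ
    G v = (v - h) * F v
    G₊ = walk m (λ v → (v - (h + 1ℚ)) * F v) (h + 1ℚ)
    G₋ = walk m (λ v → (v - (h - 1ℚ)) * F v) (h - 1ℚ)
    f₊ = walk m F (h + 1ℚ)
    f₋ = walk m F (h - 1ℚ)
    k₊ = walk m K (h + 1ℚ)
    k₋ = walk m K (h - 1ℚ)
    up : walk m G (h + 1ℚ) ≡ G₊ + f₊
    up = trans
      (walk-cong m (λ v → solve 3 (λ v h f → (v :- h) :* f := (v :- (h :+ con 1ℚ)) :* f :+ f)
                            refl v h (F v)) (h + 1ℚ))
      (walk-+ m (λ v → (v - (h + 1ℚ)) * F v) F (h + 1ℚ))
    down : walk m G (h - 1ℚ) ≡ G₋ - f₋
    down = trans (solve 2 (λ g f → g := (g :+ f) :- f) refl (walk m G (h - 1ℚ)) f₋)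
      (cong (_- f₋) (trans (sym (walk-+ m G F (h - 1ℚ)))
        (walk-cong m (λ v → solve 3 (λ v h f → (v :- h) :* f :+ f := (v :- (h :- con 1ℚ)) :* f)
                              refl v h (F v)) (h - 1ℚ))))

-- The factors m * (2 j + 1) for j < k are at most m * 2 n because k ≤ n.
walk-moment : ∀ {n} m k → k ≤ n → walk m (even k) 0ℚ ≤ℚ (2ℚ * (ι n * ι m)) ^ k
walk-moment m zero    k≤n = ℚP.≤-reflexive (walk-const m 1ℚ 0ℚ)
walk-moment {n} m (suc k) k<n = begin
  walk m (even (suc k)) 0ℚ
    ≡⟨ walk-cong m (λ v → solve 2 (λ v e → (v :* v) :* e := (v :- con 0ℚ) :* (v :* e))
                            refl v (even k v)) 0ℚ ⟩
  walk m (λ v → (v - 0ℚ) * odd k v) 0ℚ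
    ≤⟨ walk-by-parts {F = odd k} {even k} {ι k + ι k + 1ℚ} (odd-increment k) m 0ℚ ⟩
  ι m * ((ι k + ι k + 1ℚ) * walk m (even k) 0ℚ)
    ≤⟨ *-monoˡ (ι-nonneg m) (*-monoˡ 0≤2k+1 (walk-moment m k (ℕP.<⇒≤ k<n))) ⟩
  ι m * ((ι k + ι k + 1ℚ) * R ^ k)
    ≤⟨ *-monoˡ (ι-nonneg m) (ℚP.*-monoʳ-≤-nonNeg (R ^ k) {{nonNegative (^-nonneg 0≤R k)}} 2k+1≤2n) ⟩
  ι m * ((2ℚ * ι n) * R ^ k)
    ≡⟨ solve 4 (λ m t n r → m :* ((t :* n) :* r) := (t :* (n :* m)) :* r) refl (ι m) 2ℚ (ι n) (R ^ k) ⟩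
  R * R ^ k ∎
  where
  open ℚP.≤-Reasoning
  R = 2ℚ * (ι n * ι m)
  0≤2 = ℚP.nonNegative⁻¹ 2ℚ
  0≤R : 0ℚ ≤ℚ R
  0≤R = *-nonneg 0≤2 (*-nonneg (ι-nonneg n) (ι-nonneg m))
  0≤2k+1 : 0ℚ ≤ℚ ι k + ι k + 1ℚ
  0≤2k+1 = ℚP.+-mono-≤ (ℚP.+-mono-≤ (ι-nonneg k) (ι-nonneg k)) 1-nonneg
  2k+1≤2n : ι k + ι k + 1ℚ ≤ℚ 2ℚ * ι n
  2k+1≤2n = begin
    ι k + ι k + 1ℚ      ≤⟨ ≤-from-gap (solve 1 (λ k → (k :+ k :+ con 1ℚ) :+ con 1ℚ
                             := con 2ℚ :* (con 1ℚ :+ k)) refl (ι k)) 1-nonneg ⟩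
    2ℚ * (1ℚ + ι k)     ≡⟨ cong (2ℚ *_) (ι-suc k) ⟨
    2ℚ * ι (suc k)      ≤⟨ *-monoˡ 0≤2 (ι-mono k<n) ⟩
    2ℚ * ι n            ∎

-- Finite sums of rationals

Σℚ : ∀ {A : Set} → List A → (A → ℚ) → ℚ
Σℚ as g = foldr (λ a s → g a + s) 0ℚ as

module _ {A : Set} where

  Σ-cong-All : ∀ {g h : A → ℚ} {as} → All (λ a → g a ≡ h a) as → Σℚ as g ≡ Σℚ as h
  Σ-cong-All []       = refl
  Σ-cong-All (e ∷ es) = cong₂ _+_ e (Σ-cong-All es)

  Σ-cong : ∀ {g h : A → ℚ} as → (∀ a → g a ≡ h a) → Σℚ as g ≡ Σℚ as h
  Σ-cong as e = Σ-cong-All (All.universal e as)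

  Σ-+ : ∀ as (g h : A → ℚ) → Σℚ as (λ a → g a + h a) ≡ Σℚ as g + Σℚ as h
  Σ-+ []       g h = refl
  Σ-+ (a ∷ as) g h = trans (cong (_+_ (g a + h a)) (Σ-+ as g h))
    (solve 4 (λ a b c d → (a :+ b) :+ (c :+ d) := (a :+ c) :+ (b :+ d)) refl
      (g a) (h a) (Σℚ as g) (Σℚ as h))

  Σ-*ˡ : ∀ c as (g : A → ℚ) → Σℚ as (λ a → c * g a) ≡ c * Σℚ as g
  Σ-*ˡ c []       g = sym (ℚP.*-zeroʳ c)
  Σ-*ˡ c (a ∷ as) g = trans (cong (_+_ (c * g a)) (Σ-*ˡ c as g))
    (sym (ℚP.*-distribˡ-+ c (g a) (Σℚ as g)))

  Σ-const : ∀ c (as : List A) → Σℚ as (λ _ → c) ≡ ι (length as) * c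
  Σ-const c []       = sym (ℚP.*-zeroˡ c)
  Σ-const c (a ∷ as) = begin
    c + Σℚ as (λ _ → c)      ≡⟨ cong (_+_ c) (Σ-const c as) ⟩
    c + ι (length as) * c    ≡⟨ solve 2 (λ c i → c :+ i :* c := (con 1ℚ :+ i) :* c) refl c (ι (length as)) ⟩
    (1ℚ + ι (length as)) * c ≡⟨ cong (_* c) (ι-suc (length as)) ⟨
    ι (suc (length as)) * c  ∎
    where open ≡-Reasoning

  Σ-mono : ∀ {g h : A → ℚ} as → (∀ a → g a ≤ℚ h a) → Σℚ as g ≤ℚ Σℚ as h
  Σ-mono []       g≤h = ℚP.≤-refl
  Σ-mono (a ∷ as) g≤h = ℚP.+-mono-≤ (g≤h a) (Σ-mono as g≤h)

  Σ-nonneg : ∀ {g : A → ℚ} → (∀ a → 0ℚ ≤ℚ g a) → ∀ as → 0ℚ ≤ℚ Σℚ as g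
  Σ-nonneg 0≤g []       = ℚP.≤-refl
  Σ-nonneg 0≤g (a ∷ as) = ℚP.+-mono-≤ (0≤g a) (Σ-nonneg 0≤g as)

  term≤Σ : ∀ {g : A → ℚ} → (∀ a → 0ℚ ≤ℚ g a) → ∀ {a as} → a ∈ as → g a ≤ℚ Σℚ as g
  term≤Σ {g} 0≤g {a} {_ ∷ as} (here refl) = ≤-from-gap refl (Σ-nonneg 0≤g as)
  term≤Σ {g} 0≤g {a} {b ∷ as} (there a∈as) = ℚP.≤-trans
    (≤-from-gap (ℚP.+-comm (g a) (g b)) (0≤g b))
    (ℚP.+-monoʳ-≤ (g b) (term≤Σ 0≤g a∈as))

  Σ-filter : ∀ {P : Pred A 0ℓ} (P? : Decidable P) (g : A → ℚ) as →
    Σℚ as (λ a → if does (P? a) then g a else 0ℚ) ≡ Σℚ (filter P? as) g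
  Σ-filter P? g []       = refl
  Σ-filter P? g (a ∷ as) with does (P? a)
  ... | true  = cong (_+_ (g a)) (Σ-filter P? g as)
  ... | false = trans (ℚP.+-identityˡ _) (Σ-filter P? g as)

  seq-∑ : ∀ (g : A → ℝ) k as → seq (∑ as g) k ≡ Σℚ as (λ a → seq (g a) k)
  seq-∑ g k []       = refl
  seq-∑ g k (a ∷ as) = cong (_+_ (seq (g a) k)) (seq-∑ g k as)

-- Signs by the method of conditional expectations

-- The rational value of a sign.
sg : Sign → ℚ
sg Sign.+ = 1ℚ
sg Sign.- = - 1ℚ

abs-sg : ∀ s → abs (sg s) ≡ 1ℚ
abs-sg Sign.+ = refl
abs-sg Sign.- = refl

-- By symmetry, multiplying the first step by a fixed sign s does not change the walk.
walk-sign : ∀ m φ h s →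
  walk (suc m) φ h ≡ ½ * (walk m φ (h + 1ℚ * sg s) + walk m φ (h + - 1ℚ * sg s))
walk-sign m φ h Sign.+ = refl
walk-sign m φ h Sign.- = cong (½ *_) (ℚP.+-comm (walk m φ (h + 1ℚ)) (walk m φ (h - 1ℚ)))

minimum≤average : ∀ (g : Sign → ℚ) → Σ[ s ∈ Sign ] g s ≤ℚ ½ * (g Sign.+ + g Sign.-)
minimum≤average g with ℚP.≤-total (g Sign.+) (g Sign.-)
... | inj₁ +≤- = Sign.+ , (begin
  g Sign.+                     ≡⟨ solve 1 (λ a → a := con ½ :* (a :+ a)) refl (g Sign.+) ⟩
  ½ * (g Sign.+ + g Sign.+)    ≤⟨ *-monoˡ ½-nonneg (ℚP.+-monoʳ-≤ (g Sign.+) +≤-) ⟩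
  ½ * (g Sign.+ + g Sign.-)    ∎)
  where open ℚP.≤-Reasoning
... | inj₂ -≤+ = Sign.- , (begin
  g Sign.-                     ≡⟨ solve 1 (λ b → b := con ½ :* (b :+ b)) refl (g Sign.-) ⟩
  ½ * (g Sign.- + g Sign.-)    ≤⟨ *-monoˡ ½-nonneg (ℚP.+-monoˡ-≤ (g Sign.-) -≤+) ⟩
  ½ * (g Sign.+ + g Sign.-)    ∎)
  where open ℚP.≤-Reasoning

module _ {A X : Set} (_≟_ : DecidableEquality A) (v : A → X → Sign) (xs : List X) (φ : ℚ → ℚ) where

  -- The sum of the ±1-valued functions v a with the signs ε a.
  signed : (A → Sign) → List A → X → ℚ
  signed ε as x = Σℚ as (λ a → sg (ε a) * sg (v a x))

  -- ε with its value at a replaced by s.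
  update : A → Sign → (A → Sign) → A → Sign
  update a s ε b = if does (b ≟ a) then s else ε b

  signed-update : ∀ a s ε {as} → All (a ≢_) as → ∀ x →
    signed (update a s ε) (a ∷ as) x ≡ sg s * sg (v a x) + signed ε as x
  signed-update a s ε {as} a∉as x = cong₂ _+_ head (Σ-cong-All (All.map tail a∉as))
    where
    head : sg (update a s ε a) * sg (v a x) ≡ sg s * sg (v a x)
    head with a ≟ a
    ... | yes _  = refl
    ... | no a≢a = contradiction refl a≢a
    tail : ∀ {b} → a ≢ b → sg (update a s ε b) * sg (v b x) ≡ sg (ε b) * sg (v b x)
    tail {b} a≢b with b ≟ a
    ... | yes b≡a = contradiction (sym b≡a) a≢b
    ... | no _    = refl

  -- With uniformly random signs, φ (h x + signed ε as x) has expectation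
  -- walk (length as) φ (h x), the function x ↦ h x recording the signs already fixed.  The sign
  -- of the head is chosen so that the expected sum over xs, conditioned on it, does not increase.
  -- Repetitions in as are excluded because they would force equal signs.
  exists-signs : ∀ {as} → Unique as → (h : X → ℚ) → Σ[ ε ∈ (A → Sign) ]
    Σℚ xs (λ x → φ (h x + signed ε as x)) ≤ℚ Σℚ xs (λ x → walk (length as) φ (h x))
  exists-signs {[]} [] h = (λ _ → Sign.+) ,
    ℚP.≤-reflexive (Σ-cong xs (λ x → cong φ (ℚP.+-identityʳ (h x))))
  exists-signs {a ∷ as} (a∉as ∷ unique) h = update a s ε , (begin
    Σℚ xs (λ x → φ (h x + signed (update a s ε) (a ∷ as) x))
      ≡⟨ Σ-cong xs (λ x → cong φ (trans (cong (_+_ (h x)) (signed-update a s ε a∉as x))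
           (sym (ℚP.+-assoc (h x) _ _)))) ⟩
    Σℚ xs (λ x → φ (moved s x + signed ε as x))
      ≤⟨ proj₂ rest ⟩
    after s
      ≤⟨ proj₂ choice ⟩
    ½ * (after Sign.+ + after Sign.-)
      ≡⟨ cong (½ *_) (Σ-+ xs (future Sign.+) (future Sign.-)) ⟨
    ½ * Σℚ xs (λ x → future Sign.+ x + future Sign.- x)
      ≡⟨ Σ-*ˡ ½ xs (λ x → future Sign.+ x + future Sign.- x) ⟨
    Σℚ xs (λ x → ½ * (future Sign.+ x + future Sign.- x))
      ≡⟨ Σ-cong xs (λ x → walk-sign m φ (h x) (v a x)) ⟨
    Σℚ xs (λ x → walk (suc m) φ (h x)) ∎)
    where
    open ℚP.≤-Reasoning
    m = length as
    moved : Sign → X → ℚ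
    moved s x = h x + sg s * sg (v a x)
    future : Sign → X → ℚ
    future s x = walk m φ (moved s x)
    -- The conditional expectation of the sum over xs once the sign of a is s.
    after : Sign → ℚ
    after s = Σℚ xs (future s)
    choice = minimum≤average after
    s = proj₁ choice
    rest = exists-signs unique (moved s)
    ε = proj₁ rest

-- Enumeration of the cube and of the d-subsets

-- All points of the cube, each listed once.
cube : ∀ n → List (Cube n)
cube zero    = [] ∷ []
cube (suc n) = map (Sign.+ ∷_) (cube n) ++ map (Sign.- ∷_) (cube n)

∈-cube : ∀ {n} (x : Cube n) → x ∈ cube n
∈-cube []             = here refl
∈-cube (Sign.+ ∷ x)   = ∈-++⁺ˡ (∈-map⁺ _ (∈-cube x))
∈-cube (Sign.- ∷ x)   = ∈-++⁺ʳ _ (∈-map⁺ _ (∈-cube x))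

ι-length-cube : ∀ n → ι (length (cube n)) ≡ 2ℚ ^ n
ι-length-cube zero    = refl
ι-length-cube (suc n) = begin
  ι (length (map (Sign.+ ∷_) (cube n) ++ map (Sign.- ∷_) (cube n)))
    ≡⟨ cong ι (length-++ (map (Sign.+ ∷_) (cube n))) ⟩
  ι (length (map (Sign.+ ∷_) (cube n)) ℕ.+ length (map (Sign.- ∷_) (cube n)))
    ≡⟨ cong₂ (λ j k → ι (j ℕ.+ k)) (length-map _ (cube n)) (length-map _ (cube n)) ⟩
  ι (length (cube n) ℕ.+ length (cube n))
    ≡⟨ ι-+ (length (cube n)) (length (cube n)) ⟩
  ι (length (cube n)) + ι (length (cube n))
    ≡⟨ cong (λ q → q + q) (ι-length-cube n) ⟩
  2ℚ ^ n + 2ℚ ^ n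
    ≡⟨ solve 1 (λ q → q :+ q := con 2ℚ :* q) refl (2ℚ ^ n) ⟩
  2ℚ ^ suc n ∎
  where open ≡-Reasoning

subsets-unique : ∀ n → Unique (subsets n)
subsets-unique zero    = [] ∷ []
subsets-unique (suc n) = Unique.++⁺
  (Unique.map⁺ Vec.∷-injectiveʳ (subsets-unique n))
  (Unique.map⁺ Vec.∷-injectiveʳ (subsets-unique n))
  disjoint
  where
  disjoint : ∀ {S} → ¬ (S ∈ map (outside ∷_) (subsets n) × S ∈ map (inside ∷_) (subsets n))
  disjoint (out , in′) with ∈-map⁻ _ out | ∈-map⁻ _ in′
  ... | _ , _ , refl | _ , _ , ()

-- The subsets with d elements.
level : ∀ n → ℕ → List (Subset n)
level n d = filter (λ S → ∣ S ∣ ℕ.≟ d) (subsets n)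

length-filter-map : ∀ {A B : Set} {P : Pred B 0ℓ} (P? : Decidable P) (g : A → B) as →
  length (filter P? (map g as)) ≡ length (filter (P? ∘ g) as)
length-filter-map P? g []       = refl
length-filter-map P? g (a ∷ as) with does (P? (g a))
... | true  = cong suc (length-filter-map P? g as)
... | false = length-filter-map P? g as

length-level-split : ∀ n d → length (level (suc n) d)
  ≡ length (level n d) ℕ.+ length (filter (λ S → suc ∣ S ∣ ℕ.≟ d) (subsets n))
length-level-split n d = begin
  length (filter P? (map (outside ∷_) (subsets n) ++ map (inside ∷_) (subsets n)))
    ≡⟨ cong length (filter-++ P? (map (outside ∷_) (subsets n)) _) ⟩
  length (filter P? (map (outside ∷_) (subsets n)) ++ filter P? (map (inside ∷_) (subsets n)))
    ≡⟨ length-++ (filter P? (map (outside ∷_) (subsets n))) ⟩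
  length (filter P? (map (outside ∷_) (subsets n))) ℕ.+ length (filter P? (map (inside ∷_) (subsets n)))
    ≡⟨ cong₂ ℕ._+_ (length-filter-map P? _ (subsets n)) (length-filter-map P? _ (subsets n)) ⟩
  length (level n d) ℕ.+ length (filter (λ S → suc ∣ S ∣ ℕ.≟ d) (subsets n)) ∎
  where
  open ≡-Reasoning
  P? : (S : Subset (suc n)) → Dec (∣ S ∣ ≡ d)
  P? S = ∣ S ∣ ℕ.≟ d

length-level : ∀ n d → length (level n d) ≡ n C d
length-level zero    zero    = refl
length-level zero    (suc d) = refl
length-level (suc n) zero    = begin
  length (level (suc n) 0)
    ≡⟨ length-level-split n 0 ⟩
  length (level n 0) ℕ.+ length (filter (λ S → suc ∣ S ∣ ℕ.≟ 0) (subsets n))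
    ≡⟨ cong₂ ℕ._+_ (length-level n 0)
         (cong length (filter-none (λ S → suc ∣ S ∣ ℕ.≟ 0) (All.universal (λ _ ()) (subsets n)))) ⟩
  n C 0 ℕ.+ 0
    ≡⟨⟩
  suc n C 0 ∎
  where open ≡-Reasoning
length-level (suc n) (suc d) = begin
  length (level (suc n) (suc d))
    ≡⟨ length-level-split n (suc d) ⟩
  length (level n (suc d)) ℕ.+ length (filter (λ S → suc ∣ S ∣ ℕ.≟ suc d) (subsets n))
    ≡⟨ cong₂ ℕ._+_ (length-level n (suc d))
         (cong length (filter-≐ (λ S → suc ∣ S ∣ ℕ.≟ suc d) (λ S → ∣ S ∣ ℕ.≟ d)
           (ℕP.suc-injective , cong suc) (subsets n))) ⟩
  n C suc d ℕ.+ length (level n d)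
    ≡⟨ cong (n C suc d ℕ.+_) (length-level n d) ⟩
  n C suc d ℕ.+ n C d
    ≡⟨ ℕP.+-comm (n C suc d) (n C d) ⟩
  n C d ℕ.+ n C suc d
    ≡⟨ nCk+nC[k+1]≡[n+1]C[k+1] n d ⟩
  suc n C suc d ∎
  where open ≡-Reasoning

nCk>0 : ∀ {n k} → k ≤ n → 0 ℕ.< n C k
nCk>0 {n}     {zero}  z≤n     = s≤s z≤n
nCk>0 {suc n} {suc k} (s≤s h) = subst (0 ℕ.<_) (nCk+nC[k+1]≡[n+1]C[k+1] n k)
  (ℕP.<-≤-trans (nCk>0 h) (ℕP.m≤m+n (n C k) (n C suc k)))

-- Small signed sums of characters

-- The polynomial with coefficients ε S = ±1 on the subsets of size d and 0 elsewhere.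
character-sum : ∀ {n} → ℕ → (Subset n → Sign) → Cube n → ℚ
character-sum {n} d ε x = Σℚ (level n d) (λ S → sg (ε S) * sg (χ S x))

-- The bound is (g x)² ≤ 4 n N: one factor 2 comes from the moment bound, the other is the n-th
-- root of the number of points of the cube.
balanced-signs : ∀ n d .{{_ : NonZero n}} → Σ[ ε ∈ (Subset n → Sign) ]
  (∀ x → character-sum d ε x * character-sum d ε x ≤ℚ 2ℚ * (2ℚ * (ι n * ι (n C d))))
balanced-signs n@(suc n′) d = ε , λ x → ^-cancel-≤ 0≤bound n′ (begin
  even n (g x)                                          ≡⟨ cong (even n) (ℚP.+-identityˡ (g x)) ⟨
  even n (0ℚ + g x)                                     ≤⟨ term≤Σ (λ x → ^-nonneg (square-nonneg (0ℚ + g x)) n) (∈-cube x) ⟩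
  Σℚ (cube n) (λ x → even n (0ℚ + g x))                 ≤⟨ proj₂ signs ⟩
  Σℚ (cube n) (λ _ → walk m (even n) 0ℚ)                ≤⟨ Σ-mono (cube n) (λ _ → walk-moment m n ℕP.≤-refl) ⟩
  Σℚ (cube n) (λ _ → (2ℚ * (ι n * ι m)) ^ n)            ≡⟨ Σ-const _ (cube n) ⟩
  ι (length (cube n)) * (2ℚ * (ι n * ι m)) ^ n          ≡⟨ cong (_* (2ℚ * (ι n * ι m)) ^ n) (ι-length-cube n) ⟩
  2ℚ ^ n * (2ℚ * (ι n * ι m)) ^ n                       ≡⟨ ^-distrib-* 2ℚ (2ℚ * (ι n * ι m)) n ⟨
  (2ℚ * (2ℚ * (ι n * ι m))) ^ n                         ≡⟨ cong (λ m → (2ℚ * (2ℚ * (ι n * ι m))) ^ n) (length-level n d) ⟩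
  (2ℚ * (2ℚ * (ι n * ι (n C d)))) ^ n                   ∎)
  where
  open ℚP.≤-Reasoning
  m = length (level n d)
  signs = exists-signs (Vec.≡-dec Bool._≟_) χ (cube n) (even n)
    (Unique.filter⁺ (λ S → ∣ S ∣ ℕ.≟ d) (subsets-unique n)) (λ _ → 0ℚ)
  ε = proj₁ signs
  g = character-sum d ε
  0≤2 = ℚP.nonNegative⁻¹ 2ℚ
  0≤bound : 0ℚ ≤ℚ 2ℚ * (2ℚ * (ι n * ι (n C d)))
  0≤bound = *-nonneg 0≤2 (*-nonneg 0≤2 (*-nonneg (ι-nonneg n) (ι-nonneg (n C d))))

-- The polynomial

≡⇒≃ : ∀ {x y} → (∀ k → seq x k ≡ seq y k) → x ≃ y
≡⇒≃ {x} {y} e ε 0<ε = 0 , λ k _ → begin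
  abs (seq x k - seq y k)  ≡⟨ cong (λ z → abs (z - seq y k)) (e k) ⟩
  abs (seq y k - seq y k)  ≡⟨ cong abs (ℚP.+-inverseʳ (seq y k)) ⟩
  0ℚ                       ≤⟨ ℚP.<⇒≤ 0<ε ⟩
  ε                        ∎
  where open ℚP.≤-Reasoning

≤⇒≤ᴿ : ∀ {x y} → (∀ k → seq x k ≤ℚ seq y k) → x ≤ᴿ y
≤⇒≤ᴿ {x} {y} h ε 0<ε = 0 , λ k _ →
  ℚP.≤-trans (h k) (≤-from-gap refl (ℚP.<⇒≤ 0<ε))

seq-fromSign : ∀ s k → seq (fromSign s) k ≡ sg s
seq-fromSign Sign.+ k = refl
seq-fromSign Sign.- k = refl

-- The polynomial obtained by scaling a balanced signed sum of characters.
module Construction (n d : ℕ) .{{_ : NonZero n}} .{{_ : NonZero (n C d)}} (ε : Subset n → Sign)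
  (balanced : ∀ x → character-sum d ε x * character-sum d ε x ≤ℚ 2ℚ * (2ℚ * (ι n * ι (n C d)))) where

  N : ℕ
  N = n C d

  q : ℚ
  q = (+ 1 / n) * ι N

  0≤q : 0ℚ ≤ℚ q
  0≤q = *-nonneg (ℚP.nonNegative⁻¹ (+ 1 / n) {{ℚP.normalize-nonNeg 1 n}}) (ι-nonneg N)

  g : Cube n → ℚ
  g = character-sum d ε

  -- The coefficient of χ S before scaling.
  level-coefficient : Subset n → ℚ
  level-coefficient S = if does (∣ S ∣ ℕ.≟ d) then sg (ε S) else 0ℚ

  level-coefficient-on : ∀ S → ∣ S ∣ ≡ d → level-coefficient S ≡ sg (ε S)
  level-coefficient-on S e = cong (λ b → if b then sg (ε S) else 0ℚ) (dec-true (∣ S ∣ ℕ.≟ d) e)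

  level-coefficient-off : ∀ S → ∣ S ∣ ≢ d → level-coefficient S ≡ 0ℚ
  level-coefficient-off S ¬e = cong (λ b → if b then sg (ε S) else 0ℚ) (dec-false (∣ S ∣ ℕ.≟ d) ¬e)

  -- The common absolute value of the nonzero coefficients.
  size : ℝ
  size = fromℚ (½ * (+ 1 / N)) *ᴿ √ q

  size-nonneg : ∀ k → 0ℚ ≤ℚ seq size k
  size-nonneg k = *-nonneg
    (*-nonneg ½-nonneg (ℚP.nonNegative⁻¹ (+ 1 / N) {{ℚP.normalize-nonNeg 1 N}})) (0≤lower q k)

  f̂ : Subset n → ℝ
  f̂ S = fromℚ (level-coefficient S) *ᴿ size

  f : Cube n → ℝ
  f x = ∑ (subsets n) (λ S → f̂ S *ᴿ fromSign (χ S x))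

  seq-f : ∀ x k → seq (f x) k ≡ seq size k * g x
  seq-f x k = begin
    seq (f x) k
      ≡⟨ seq-∑ (λ S → f̂ S *ᴿ fromSign (χ S x)) k (subsets n) ⟩
    Σℚ (subsets n) (λ S → level-coefficient S * a * seq (fromSign (χ S x)) k)
      ≡⟨ Σ-cong (subsets n) term ⟩
    Σℚ (subsets n) (λ S → if does (∣ S ∣ ℕ.≟ d) then a * (sg (ε S) * sg (χ S x)) else 0ℚ)
      ≡⟨ Σ-filter (λ S → ∣ S ∣ ℕ.≟ d) (λ S → a * (sg (ε S) * sg (χ S x))) (subsets n) ⟩
    Σℚ (level n d) (λ S → a * (sg (ε S) * sg (χ S x)))
      ≡⟨ Σ-*ˡ a (level n d) (λ S → sg (ε S) * sg (χ S x)) ⟩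
    a * g x ∎
    where
    open ≡-Reasoning
    a = seq size k
    term : ∀ S → level-coefficient S * a * seq (fromSign (χ S x)) k
      ≡ (if does (∣ S ∣ ℕ.≟ d) then a * (sg (ε S) * sg (χ S x)) else 0ℚ)
    term S rewrite seq-fromSign (χ S x) k with does (∣ S ∣ ℕ.≟ d)
    ... | true  = solve 3 (λ e a s → e :* a :* s := a :* (e :* s)) refl (sg (ε S)) a (sg (χ S x))
    ... | false = solve 2 (λ a s → con 0ℚ :* a :* s := con 0ℚ) refl a (sg (χ S x))

  -- (size · g x)² ≤ (1 / 4N²) · (N / n) · 4nN = 1.
  f-square : ∀ x k → seq (f x) k * seq (f x) k ≤ℚ 1ℚ
  f-square x k = begin
    seq (f x) k * seq (f x) k
      ≡⟨ cong (λ z → z * z) (seq-f x k) ⟩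
    (½ * r * l * g x) * (½ * r * l * g x)
      ≡⟨ solve 3 (λ c l g → (c :* l :* g) :* (c :* l :* g) := (c :* c) :* ((l :* l) :* (g :* g)))
           refl (½ * r) l (g x) ⟩
    (½ * r) * (½ * r) * ((l * l) * (g x * g x))
      ≤⟨ *-monoˡ (square-nonneg (½ * r)) (*-mono 0≤q (square-nonneg (g x))
           (lower-square q 0≤q k) (balanced x)) ⟩
    (½ * r) * (½ * r) * (q * (2ℚ * (2ℚ * (ι n * ι N))))
      ≡⟨ solve 4 (λ r i n N → (con ½ :* r) :* (con ½ :* r)
             :* ((i :* N) :* (con 2ℚ :* (con 2ℚ :* (n :* N))))
           := (r :* N) :* (r :* N) :* (i :* n)) refl r (+ 1 / n) (ι n) (ι N) ⟩
    (r * ι N) * (r * ι N) * ((+ 1 / n) * ι n)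
      ≡⟨ cong₂ (λ y z → y * y * z) (1/n*n≡1 N) (1/n*n≡1 n) ⟩
    1ℚ ∎
    where
    open ℚP.≤-Reasoning
    r = + 1 / N
    l = √lower q k

  seq-ℓ¹-norm : ∀ k → seq (ℓ¹-norm d f̂) k ≡ ½ * √lower q k
  seq-ℓ¹-norm k = begin
    seq (ℓ¹-norm d f̂) k
      ≡⟨ seq-∑ (λ S → ∣ f̂ S ∣ᴿ) k (level n d) ⟩
    Σℚ (level n d) (λ S → abs (level-coefficient S * a))
      ≡⟨ Σ-cong-All (All.map (λ {S} → term S) (all-filter (λ S → ∣ S ∣ ℕ.≟ d) (subsets n))) ⟩
    Σℚ (level n d) (λ _ → a)
      ≡⟨ Σ-const a (level n d) ⟩
    ι (length (level n d)) * a
      ≡⟨ cong (λ m → ι m * a) (length-level n d) ⟩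
    ι N * (½ * r * √lower q k)
      ≡⟨ solve 3 (λ N r l → N :* (con ½ :* r :* l) := (r :* N) :* (con ½ :* l))
           refl (ι N) r (√lower q k) ⟩
    r * ι N * (½ * √lower q k)
      ≡⟨ cong (_* (½ * √lower q k)) (1/n*n≡1 N) ⟩
    1ℚ * (½ * √lower q k)
      ≡⟨ ℚP.*-identityˡ (½ * √lower q k) ⟩
    ½ * √lower q k ∎
    where
    open ≡-Reasoning
    a = seq size k
    r = + 1 / N
    term : ∀ S → ∣ S ∣ ≡ d → abs (level-coefficient S * a) ≡ a
    term S e = begin
      abs (level-coefficient S * a)      ≡⟨ ℚP.∣p*q∣≡∣p∣*∣q∣ (level-coefficient S) a ⟩
      abs (level-coefficient S) * abs a  ≡⟨ cong₂ _*_ (trans (cong abs (level-coefficient-on S e)) (abs-sg (ε S)))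
                                       (ℚP.0≤p⇒∣p∣≡p (size-nonneg k)) ⟩
      1ℚ * a                      ≡⟨ ℚP.*-identityˡ a ⟩
      a                           ∎

proposition4 : ∀ (n d : ℕ) (1≤d : 1 ≤ d) (d≤n : d ≤ n) →
    let instance n≢0 = >-nonZero (≤-trans 1≤d d≤n) in
    Σ[ f ∈ (Cube n → ℝ) ] Σ[ f̂ ∈ (Subset n → ℝ) ]
    f HasFourierCoefficients f̂
    × Homogeneous d f̂
    × (∀ x → fromℚ (- 1ℚ) ≤ᴿ f x × f x ≤ᴿ fromℚ 1ℚ)
    × ℓ¹-norm d f̂ ≃ fromℚ ½ *ᴿ √ ((+ 1 / n) * (+ (n C d) / 1))
proposition4 zero     d 1≤d d≤n = contradiction (≤-trans 1≤d d≤n) λ ()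
proposition4 (suc n′) d 1≤d d≤n =
  f , f̂ ,
  (λ x → ≡⇒≃ {f x} {f x} (λ _ → refl)) ,
  (λ S ∣S∣≢d → ≡⇒≃ {f̂ S} {0ᴿ} λ k →
    trans (cong (_* seq size k) (level-coefficient-off S ∣S∣≢d)) (ℚP.*-zeroˡ (seq size k))) ,
  (λ x → ≤⇒≤ᴿ {fromℚ (- 1ℚ)} {f x} (λ k → proj₁ (square≤1⇒bounded (seq (f x) k) (f-square x k)))
       , ≤⇒≤ᴿ {f x} {fromℚ 1ℚ} (λ k → proj₂ (square≤1⇒bounded (seq (f x) k) (f-square x k)))) ,
  ≡⇒≃ {ℓ¹-norm d f̂} {fromℚ ½ *ᴿ √ q} seq-ℓ¹-norm
  where
  instance
    nCd≢0 : NonZero (suc n′ C d)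
    nCd≢0 = >-nonZero (nCk>0 d≤n)
  signs = balanced-signs (suc n′) d
  open Construction (suc n′) d (proj₁ signs) (proj₂ signs)
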